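{- Let $G$ be a nontrivial connected graph. Then: (a) $pvc(G)=0$ if and only if $G$ is a complete graph; (b) $pvc(G)=1$ if and only if $diam(G)=2$.
   Context: All graphs are simple, finite and undirected; nontrivial means having at least two vertices. Vertex-colorings are arbitrary (adjacent vertices may receive the same color). A path in a vertex-colored graph is a vertex-proper path if any two adjacent internal vertices of the path differ in color (the end-vertices of the path are not internal). A vertex-colored graph is proper vertex-connected if any two distinct vertices are joined by a vertex-proper path. For a connected graph $G$, $pvc(G)$ is the smallest number of colors required to make $G$ proper vertex-connected. The value $0$ is allowed: $pvc(G)=0$ means that no vertex needs to be colored, where an uncolored path counts as vertex-proper exactly when it has no internal vertices. $diam(G)$ is the maximum distance between two vertices of $G$. -}

module Defs where

open import Level using (0ℓ)
open import Data.Nat using (ℕ; zero; suc; _≤_)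
open import Data.Fin using (Fin)
open import Data.List using (List; []; _∷_; [_])
open import Data.List.Relation.Unary.Linked using (Linked)
open import Data.List.Relation.Unary.Unique.Propositional using (Unique)
open import Data.Product using (∃; ∃₂; Σ; _×_; proj₁)
open import Relation.Binary using (Rel; Symmetric; Irreflexive; Decidable)
open import Relation.Binary.Construct.Closure.ReflexiveTransitive using (Star; ε; _◅_)
open import Relation.Binary.PropositionalEquality using (_≡_; _≢_)
open import Relation.Unary using (Pred)

IsLeast : Pred ℕ 0ℓ → ℕ → Set
IsLeast P k = P k × (∀ m → P m → k ≤ m)

IsGreatest : Pred ℕ 0ℓ → ℕ → Set
IsGreatest P k = P k × (∀ m → P m → m ≤ k)

record Graph (n : ℕ) : Set₁ where
  field
    Adj    : Rel (Fin n) 0ℓ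
    sym    : Symmetric Adj
    irrefl : Irreflexive _≡_ Adj
    adj?   : Decidable Adj

module _ {n : ℕ} (G : Graph n) where
  open Graph G

  Complete : Set
  Complete = ∀ u v → u ≢ v → Adj u v

  Walk : Rel (Fin n) 0ℓ
  Walk = Star Adj

  Connected : Set
  Connected = ∀ u v → Walk u v

  length : ∀ {u v} → Walk u v → ℕ
  length ε       = zero
  length (_ ◅ p) = suc (length p)

  vertices : ∀ {u v} → Walk u v → List (Fin n)
  vertices {u} ε       = [ u ]
  vertices {u} (_ ◅ p) = u ∷ vertices p

  -- The vertices of the walk, in order, without its first and last entries.
  internal : ∀ {u v} → Walk u v → List (Fin n)
  internal ε                         = []
  internal (_ ◅ ε)                   = []
  internal (_ ◅ p@(_◅_ {i = w} _ _)) = w ∷ internal p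

  Path : Rel (Fin n) 0ℓ
  Path u v = Σ (Walk u v) λ p → Unique (vertices p)

  -- IsDistance u v d and IsDiameter d express d(u , v) = d and diam(G) = d.
  IsDistance : Fin n → Fin n → ℕ → Set
  IsDistance u v = IsLeast λ ℓ → Σ (Path u v) λ p → length (proj₁ p) ≡ ℓ

  IsDiameter : ℕ → Set
  IsDiameter = IsGreatest λ d → ∃₂ λ u v → IsDistance u v d

  -- Zero colors means leaving all vertices uncolored. A map into Fin 0
  -- would not do, since none exists once there is a vertex.
  data Coloring : ℕ → Set where
    uncolored : Coloring zero
    colored   : ∀ {k} → (Fin n → Fin (suc k)) → Coloring (suc k)

  -- Adjacent internal vertices are those consecutive along the path.
  VertexProper : ∀ {k u v} → Coloring k → Path u v → Set
  VertexProper uncolored   p = internal (proj₁ p) ≡ []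
  VertexProper (colored c) p = Linked (λ x y → c x ≢ c y) (internal (proj₁ p))

  ProperVertexConnected : ∀ {k} → Coloring k → Set
  ProperVertexConnected c = ∀ u v → u ≢ v → Σ (Path u v) (VertexProper c)

  -- IsPvc k expresses pvc(G) = k. Colorings need not use every color,
  -- which does not affect the minimum.
  IsPvc : ℕ → Set
  IsPvc = IsLeast λ k → ∃ λ (c : Coloring k) → ProperVertexConnected c

{-# OPTIONS --safe #-}
module Submission where

open import Data.Empty using (⊥-elim)
open import Data.Fin using (Fin; zero)
open import Data.Fin.Properties using (_≟_; any?)
open import Data.List.Relation.Unary.All using ([]; _∷_)
open import Data.List.Relation.Unary.AllPairs using ([]; _∷_)
open import Data.List.Relation.Unary.Linked using ([]; [-]; _∷_)
open import Data.Nat using (ℕ; zero; suc; _≤_; z≤n; s≤s)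
open import Data.Nat.Properties using (≤-trans; ≤-antisym; ≤⇒≯; ≤-refl)
open import Data.Product using (∃; ∃₂; Σ; _×_; _,_; proj₁)
open import Data.Sum using (_⊎_; inj₁; inj₂)
open import Function.Base using (_∘_)
open import Function.Bundles using (_⇔_; mk⇔)
open import Relation.Binary using (Decidable)
open import Relation.Binary.Construct.Closure.ReflexiveTransitive using (ε; _◅_)
open import Relation.Binary.PropositionalEquality using (_≡_; _≢_; refl)
open import Relation.Nullary using (¬_; yes; no)
open import Relation.Nullary.Decidable using (¬?; _×-dec_; _⊎-dec_; decidable-stable)
open import Defs

-- A path without internal vertices is an edge, and under a single color a
-- vertex-proper path is one with at most one internal vertex, i.e. of length at
-- most 2.  Conversely, if some vertex were at distance more than 2 from x, the
-- first vertex on a walk from x that leaves the ball of radius 2 would be at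
-- distance exactly 3, so the diameter would not be 2.

Fin1-irrelevant : (i j : Fin 1) → i ≡ j
Fin1-irrelevant zero zero = refl

module _ {n : ℕ} (G : Graph n) where
  open Graph G

  adj⇒≢ : ∀ {u v} → Adj u v → u ≢ v
  adj⇒≢ a u≡v = irrefl u≡v a

  trivialPath : ∀ u → Path G u u
  trivialPath u = ε , [] ∷ []

  edgePath : ∀ {u v} → Adj u v → Path G u v
  edgePath a = a ◅ ε , (adj⇒≢ a ∷ []) ∷ [] ∷ []

  twoEdgePath : ∀ {u w v} → Adj u w → Adj w v → u ≢ v → Path G u v
  twoEdgePath a b u≢v =
    a ◅ b ◅ ε , (adj⇒≢ a ∷ u≢v ∷ []) ∷ (adj⇒≢ b ∷ []) ∷ [] ∷ []

  complete⇒proper-uncolored : Complete G → ProperVertexConnected G uncolored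
  complete⇒proper-uncolored K u v u≢v = edgePath (K u v u≢v) , refl

  proper-uncolored⇒complete : ProperVertexConnected G uncolored → Complete G
  proper-uncolored⇒complete pc u v u≢v with pc u v u≢v
  ... | (ε           , _) , _  = ⊥-elim (u≢v refl)
  ... | (a ◅ ε       , _) , _  = a
  -- Two or more edges leave a nonempty list of internal vertices, which cannot equal `[]`.
  ... | (_ ◅ _ ◅ _   , _) , ()

  pvc0⇒complete : IsPvc G 0 → Complete G
  pvc0⇒complete ((uncolored , pc) , _) = proper-uncolored⇒complete pc

  complete⇒pvc0 : Complete G → IsPvc G 0
  complete⇒pvc0 K = (uncolored , complete⇒proper-uncolored K) , λ _ _ → z≤n

  -- Adjacency is decidable on finitely many vertices, so an exhaustive search yields the pair
  -- constructively. It will realise the distance 2.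
  ¬complete⇒nonadjacent : ¬ Complete G → ∃₂ λ u v → u ≢ v × ¬ Adj u v
  ¬complete⇒nonadjacent ¬K
    with any? (λ u → any? λ v → ¬? (u ≟ v) ×-dec ¬? (adj? u v))
  ... | yes p = p
  ... | no ¬p = ⊥-elim (¬K λ u v u≢v →
          decidable-stable (adj? u v) λ ¬a → ¬p (u , v , u≢v , ¬a))

  nonadjacent⇒2≤length : ∀ {u v} → u ≢ v → ¬ Adj u v → (p : Walk G u v) → 2 ≤ length G p
  nonadjacent⇒2≤length u≢v ¬a ε           = ⊥-elim (u≢v refl)
  nonadjacent⇒2≤length u≢v ¬a (a ◅ ε)     = ⊥-elim (¬a a)
  nonadjacent⇒2≤length u≢v ¬a (_ ◅ _ ◅ _) = s≤s (s≤s z≤n)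

  complete⇒distance≤1 : Complete G → ∀ {u v d} → IsDistance G u v d → d ≤ 1
  complete⇒distance≤1 K {u} {v} (_ , least) with u ≟ v
  ... | yes refl = ≤-trans (least 0 (trivialPath u , refl)) z≤n
  ... | no u≢v   = least 1 (edgePath (K u v u≢v) , refl)

  monochromatic-length≤2 : (c : Fin n → Fin 1) → ∀ {u v} (p : Path G u v) →
    VertexProper G (colored c) p → length G (proj₁ p) ≤ 2
  monochromatic-length≤2 c (ε               , _) _ = z≤n
  monochromatic-length≤2 c (_ ◅ ε           , _) _ = s≤s z≤n
  monochromatic-length≤2 c (_ ◅ _ ◅ ε       , _) _ = ≤-refl
  -- With three edges the first two internal vertices are consecutive and would need different
  -- colors.
  monochromatic-length≤2 c (_ ◅ _ ◅ _ ◅ _   , _) (c≢ ∷ _) =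
    ⊥-elim (c≢ (Fin1-irrelevant _ _))

  pvc1⇒diameter2 : IsPvc G 1 → IsDiameter G 2
  pvc1⇒diameter2 ((colored c , pc) , least)
    -- By minimality of 1 the graph is not complete: otherwise zero colors would suffice.
    with ¬complete⇒nonadjacent
           (λ K → ≤⇒≯ (least 0 (uncolored , complete⇒proper-uncolored K)) ≤-refl)
  ... | u , v , u≢v , ¬a = (u , v , distance2) , λ _ (x , y , d) → distance≤2 x y d
    where
    shortPath : ∀ x y → x ≢ y → Σ (Path G x y) λ p → length G (proj₁ p) ≤ 2
    shortPath x y x≢y with pc x y x≢y
    ... | p , proper = p , monochromatic-length≤2 c p proper

    distance2 : IsDistance G u v 2
    distance2 with shortPath u v u≢v
    ... | p , l≤2 = (p , ≤-antisym l≤2 (nonadjacent⇒2≤length u≢v ¬a (proj₁ p)))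
                  , λ { _ (q , refl) → nonadjacent⇒2≤length u≢v ¬a (proj₁ q) }

    distance≤2 : ∀ x y {d} → IsDistance G x y d → d ≤ 2
    distance≤2 x y (_ , least-xy) with x ≟ y
    -- The coloring provides paths between distinct vertices only.
    ... | yes refl = ≤-trans (least-xy 0 (trivialPath x , refl)) z≤n
    ... | no x≢y with shortPath x y x≢y
    ...   | p , l≤2 = ≤-trans (least-xy _ (p , refl)) l≤2

  -- The ball of radius 2, spelled out by edges rather than by distance so that membership is
  -- decidable by finite search.
  Within2 : Fin n → Fin n → Set
  Within2 x y = x ≡ y ⊎ Adj x y ⊎ ∃ λ w → Adj x w × Adj w y

  within2? : Decidable Within2
  within2? x y =
    (x ≟ y) ⊎-dec (adj? x y) ⊎-dec any? (λ w → adj? x w ×-dec adj? w y)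

  ¬within2⇒3≤length : ∀ {x y} → ¬ Within2 x y → (p : Walk G x y) → 3 ≤ length G p
  ¬within2⇒3≤length far ε               = ⊥-elim (far (inj₁ refl))
  ¬within2⇒3≤length far (a ◅ ε)         = ⊥-elim (far (inj₂ (inj₁ a)))
  ¬within2⇒3≤length far (a ◅ b ◅ ε)     = ⊥-elim (far (inj₂ (inj₂ (_ , a , b))))
  ¬within2⇒3≤length far (_ ◅ _ ◅ _ ◅ _) = s≤s (s≤s (s≤s z≤n))

  leaving-ball⇒distance3 : ∀ {x u v} → Within2 x u → Adj u v → ¬ Within2 x v →
    IsDistance G x v 3
  leaving-ball⇒distance3 (inj₁ refl)     e far = ⊥-elim (far (inj₂ (inj₁ e)))
  leaving-ball⇒distance3 (inj₂ (inj₁ a)) e far = ⊥-elim (far (inj₂ (inj₂ (_ , a , e))))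
  leaving-ball⇒distance3 (inj₂ (inj₂ (w , a , b))) e far =
      ((a ◅ b ◅ e ◅ ε
       , (adj⇒≢ a ∷ x≢u ∷ far ∘ inj₁ ∷ []) ∷ (adj⇒≢ b ∷ w≢v ∷ []) ∷ (adj⇒≢ e ∷ []) ∷ [] ∷ [])
      , refl)
    , λ { _ (q , refl) → ¬within2⇒3≤length far (proj₁ q) }
    where
    -- Either coincidence would make `v` a neighbor of `x`, through `e` or through `a`.
    x≢u = λ { refl → far (inj₂ (inj₁ e)) }
    w≢v = λ { refl → far (inj₂ (inj₁ a)) }

  -- Induction along the walk with membership in the ball as invariant. Excluding the exact distance
  -- 3 suffices, so no shortest path between arbitrary vertices has to be constructed.
  ball2-exhausts : (∀ {x y} → ¬ IsDistance G x y 3) →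
    ∀ {x u v} → Within2 x u → Walk G u v → Within2 x v
  ball2-exhausts no3 near ε = near
  ball2-exhausts no3 {x} near (e ◅ p) = ball2-exhausts no3
    (decidable-stable (within2? x _) λ far → no3 (leaving-ball⇒distance3 near e far)) p

  -- At most one internal vertex occurs, so the color condition is vacuous for every coloring.
  within2⇒proper : ∀ {k} (c : Fin n → Fin (suc k)) → ∀ {x y} → x ≢ y → Within2 x y →
    Σ (Path G x y) (VertexProper G (colored c))
  within2⇒proper c x≢y (inj₁ x≡y)                = ⊥-elim (x≢y x≡y)
  within2⇒proper c x≢y (inj₂ (inj₁ a))           = edgePath a , []
  within2⇒proper c x≢y (inj₂ (inj₂ (_ , a , b))) = twoEdgePath a b x≢y , [-]

  diameter2⇒pvc1 : Connected G → IsDiameter G 2 → IsPvc G 1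
  diameter2⇒pvc1 conn ((_ , _ , d2) , greatest) = (colored c , proper) , least
    where
    c : Fin n → Fin 1
    c _ = zero

    no3 : ∀ {x y} → ¬ IsDistance G x y 3
    no3 d3 = ≤⇒≯ (greatest 3 (_ , _ , d3)) ≤-refl

    proper : ProperVertexConnected G (colored c)
    proper x y x≢y = within2⇒proper c x≢y (ball2-exhausts no3 (inj₁ refl) (conn x y))

    least : ∀ m → (∃ λ (c : Coloring G m) → ProperVertexConnected G c) → 1 ≤ m
    least (suc _) _              = s≤s z≤n
    -- Zero colors would force completeness, hence distances at most 1, against the pair at distance
    -- 2.
    least zero (uncolored , pc) =
      ⊥-elim (≤⇒≯ (complete⇒distance≤1 (proper-uncolored⇒complete pc) d2) ≤-refl)

proposition1 : (n : ℕ) → 2 ≤ n → (G : Graph n) → Connected G →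
    (IsPvc G 0 ⇔ Complete G) × (IsPvc G 1 ⇔ IsDiameter G 2)
proposition1 n _ G conn =
    mk⇔ (pvc0⇒complete G) (complete⇒pvc0 G)
  , mk⇔ (pvc1⇒diameter2 G) (diameter2⇒pvc1 G conn)
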